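{- Let $G$ and $H$ be graphs, each with at least $2$ vertices. The strong product $G\boxtimes H$ is $1$-perfectly orientable if and only if one of the following holds: (i) every connected component of $G$ is complete and $H$ is $1$-perfectly orientable, or vice versa; (ii) every connected component of $G$ is $2$-complete and every connected component of $H$ is a co-chain graph, or vice versa.
   Context: All graphs are finite and simple. An orientation of a graph $G$ is $1$-perfect if the out-neighborhood of every vertex induces a clique in $G$; $G$ is $1$-perfectly orientable if it admits a $1$-perfect orientation. The strong product $G\boxtimes H$ has vertex set $V(G)\times V(H)$, with distinct $(u,v),(u',v')$ adjacent iff $u'\in N_G[u]$ and $v'\in N_H[v]$ (closed neighborhoods). A graph is $2$-complete if it is the union of two (not necessarily distinct) complete graphs sharing at least one vertex (equivalently, it is obtained from $K_1$ or $P_3$ by repeatedly adding true twins, where adding a true twin to $x$ means adding a new vertex adjacent to $x$ and to all neighbors of $x$). A graph $G$ is a co-chain graph if its vertex set can be partitioned into two cliques $X$ and $Y$ such that the vertices of $X$ can be ordered $x_1,\dots,x_{|X|}$ with $N[x_i]\subseteq N[x_j]$ for all $1\le i<j\le |X|$. -}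

module Defs where

open import Level using (0ℓ)
open import Data.Bool.Base using (Bool; true; false; T; if_then_else_)
open import Data.Fin.Base using (Fin; zero; suc) renaming (_<_ to _<ᶠ_)
open import Data.Fin.Properties using (0↔⊥; 1↔⊤; +↔⊎; *↔×; inj⇒≟)
open import Data.Nat.Base using (ℕ; _+_; _*_)
open import Data.Product.Base using (Σ; ∃; _×_; _,_; proj₁)
open import Data.Product.Function.Dependent.Propositional using (Σ-↔)
open import Data.Product.Function.NonDependent.Propositional using (_×-↔_)
open import Data.Sum.Base using (_⊎_; inj₁; inj₂)
open import Data.Sum.Function.Propositional using (_⊎-↔_)
open import Function.Base using (_∘_; _on_)
open import Function.Bundles using (_↔_; _⇔_; Inverse; mk↔ₛ′)
open import Function.Construct.Composition using (_↔-∘_)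
open import Function.Properties.Inverse using (↔-refl; ↔-sym; ↔⇒↣)
open import Relation.Binary.Construct.Closure.ReflexiveTransitive using (Star)
open import Relation.Binary.Core using (Rel)
open import Relation.Binary.Definitions using (Decidable; DecidableEquality; Symmetric; Irreflexive; Asymmetric)
open import Relation.Binary.PropositionalEquality.Core using (_≡_; _≢_; refl; sym; cong)
open import Relation.Nullary.Decidable using (_×-dec_; _⊎-dec_; ¬?)
open import Relation.Nullary.Negation using (¬_)

record Graph : Set₁ where
  field
    V          : Set
    order      : ℕ
    enum       : V ↔ Fin order
    Adj        : Rel V 0ℓ
    adj?       : Decidable Adj
    adj-sym    : Symmetric Adj
    adj-irrefl : Irreflexive _≡_ Adj

  _≟ⱽ_ : DecidableEquality V
  _≟ⱽ_ = inj⇒≟ (↔⇒↣ enum)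

  -- Closed neighbourhood N[u].
  _∈N[_] : V → V → Set
  v ∈N[ u ] = v ≡ u ⊎ Adj u v

  _∈N[_]? : Decidable _∈N[_]
  v ∈N[ u ]? = (v ≟ⱽ u) ⊎-dec adj? u v

  -- Boolean-valued, so that membership is decidable and proof-irrelevant
  -- and the vertex type Σ V (_∈ S) of an induced subgraph has no duplicates.
  VertexSet : Set
  VertexSet = V → Bool

  _∈_ : V → VertexSet → Set
  v ∈ S = T (S v)

  IsClique : VertexSet → Set
  IsClique S = ∀ {u v} → u ∈ S → v ∈ S → u ≢ v → Adj u v

private
  T↔Fin : ∀ b → T b ↔ Fin (if b then 1 else 0)
  T↔Fin true  = ↔-sym 1↔⊤
  T↔Fin false = ↔-sym 0↔⊥

  Σ-Fin-suc : ∀ {n} (P : Fin (ℕ.suc n) → Set) →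
              Σ (Fin (ℕ.suc n)) P ↔ (P zero ⊎ Σ (Fin n) (P ∘ suc))
  Σ-Fin-suc P = mk↔ₛ′
    (λ { (zero , p) → inj₁ p ; (suc i , p) → inj₂ (i , p) })
    (λ { (inj₁ p) → zero , p ; (inj₂ (i , p)) → suc i , p })
    (λ { (inj₁ p) → refl ; (inj₂ (i , p)) → refl })
    (λ { (zero , p) → refl ; (suc i , p) → refl })

count : ∀ n → (Fin n → Bool) → ℕ
count ℕ.zero    S = 0
count (ℕ.suc n) S = (if S zero then 1 else 0) + count n (S ∘ suc)

subset↔Fin : ∀ n (S : Fin n → Bool) → Σ (Fin n) (T ∘ S) ↔ Fin (count n S)
subset↔Fin ℕ.zero    S = mk↔ₛ′ (λ { (() , _) }) (λ ()) (λ ()) (λ { (() , _) })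
subset↔Fin (ℕ.suc n) S =
  ↔-sym +↔⊎ ↔-∘ ((T↔Fin (S zero) ⊎-↔ subset↔Fin n (S ∘ suc)) ↔-∘ Σ-Fin-suc (T ∘ S))

module _ (G : Graph) where
  open Graph G

  induced : VertexSet → Graph
  induced S = record
    { V          = Σ V (_∈ S)
    ; order      = count order (S ∘ Inverse.from enum)
    ; enum       = subset↔Fin order (S ∘ Inverse.from enum)
                     ↔-∘ ↔-sym (Σ-↔ (↔-sym enum) ↔-refl)
    ; Adj        = Adj on proj₁
    ; adj?       = λ u v → adj? (proj₁ u) (proj₁ v)
    ; adj-sym    = adj-sym
    ; adj-irrefl = λ u≡v → adj-irrefl (cong proj₁ u≡v)
    }

  IsComponent : VertexSet → Set
  IsComponent C = ∃ λ v → ∀ u → u ∈ C ⇔ Star Adj v u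

  Complete : Set
  Complete = ∀ {u v} → u ≢ v → Adj u v

  -- G is the union of the complete graphs on A and on B: V(G) = A ∪ B and
  -- E(G) = E(K_A) ∪ E(K_B), with A ∩ B nonempty.
  record TwoComplete : Set where
    field
      A B    : VertexSet
      cover  : ∀ v → v ∈ A ⊎ v ∈ B
      edges  : ∀ u v → Adj u v ⇔ (u ≢ v × ((u ∈ A × v ∈ A) ⊎ (u ∈ B × v ∈ B)))
      shared : ∃ λ v → v ∈ A × v ∈ B

  -- The parts X and Y may be empty (e.g. K₁ is a co-chain graph).
  record CoChain : Set where
    field
      X Y      : VertexSet
      cover    : ∀ v → v ∈ X ⊎ v ∈ Y
      disjoint : ∀ v → ¬ (v ∈ X × v ∈ Y)
      X-clique : IsClique X
      Y-clique : IsClique Y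
      size     : ℕ
      ordering : Fin size ↔ Σ V (_∈ X)

    x : Fin size → V
    x i = proj₁ (Inverse.to ordering i)

    field
      nested   : ∀ {i j} → i <ᶠ j → ∀ {v} → v ∈N[ x i ] → v ∈N[ x j ]

  record Orientation : Set₁ where
    field
      _⟶_    : Rel V 0ℓ
      ⟶⇒adj  : ∀ {u v} → u ⟶ v → Adj u v
      orient : ∀ {u v} → Adj u v → u ⟶ v ⊎ v ⟶ u
      asym   : Asymmetric _⟶_

  OnePerfect : Orientation → Set
  OnePerfect D = ∀ {u v w} → u ⟶ v → u ⟶ w → v ≢ w → Adj v w
    where open Orientation D

  OnePerfectlyOrientable : Set₁
  OnePerfectlyOrientable = ∃ OnePerfect

EveryComponent : ∀ {ℓ} → (Graph → Set ℓ) → Graph → Set ℓ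
EveryComponent P G = ∀ C → IsComponent G C → P (induced G C)

infixr 7 _⊠_

_⊠_ : Graph → Graph → Graph
G ⊠ H = record
  { V          = G.V × H.V
  ; order      = G.order * H.order
  ; enum       = ↔-sym *↔× ↔-∘ (G.enum ×-↔ H.enum)
  ; Adj        = _~_
  ; adj?       = λ (u , v) (u′ , v′) →
                   ¬? (≡-dec (u , v) (u′ , v′))
                     ×-dec (u′ G.∈N[ u ]? ×-dec v′ H.∈N[ v ]?)
  ; adj-sym    = λ (p≢q , u′∈ , v′∈) → p≢q ∘ sym , G-sym u′∈ , H-sym v′∈
  ; adj-irrefl = λ p≡q p~q → proj₁ p~q p≡q
  }
  where
  module G = Graph G
  module H = Graph H

  _~_ : Rel (G.V × H.V) 0ℓ
  (u , v) ~ (u′ , v′) = (u , v) ≢ (u′ , v′) × u′ G.∈N[ u ] × v′ H.∈N[ v ]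

  ≡-dec : DecidableEquality (G.V × H.V)
  ≡-dec = inj⇒≟ (↔⇒↣ (↔-sym *↔× ↔-∘ (G.enum ×-↔ H.enum)))

  G-sym : ∀ {u u′} → u′ G.∈N[ u ] → u G.∈N[ u′ ]
  G-sym (inj₁ eq) = inj₁ (sym eq)
  G-sym (inj₂ a)  = inj₂ (G.adj-sym a)

  H-sym : ∀ {v v′} → v′ H.∈N[ v ] → v H.∈N[ v′ ]
  H-sym (inj₁ eq) = inj₁ (sym eq)
  H-sym (inj₂ a)  = inj₂ (H.adj-sym a)

{-# OPTIONS --safe #-}
-- Let D be a 1-perfect orientation of G ⊠ H and let a – b – c be an induced P₃ of G. For every
-- vertex y of H one of a, c, the colour e of y, satisfies (e , y′) ⟶ (b , y) for all y′ ∈ N[y],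
-- since otherwise (b , y) would have non-adjacent out-neighbours over a and c. Cliqueness of the
-- out-neighbourhoods then makes vertices of H at distance 2, and the two middle vertices of an
-- induced P₄, differ in colour, and excludes C₄. Hence distances are at most 3, the colour
-- classes of a component are cliques, and the components of H are co-chain graphs. The colourings
-- belonging to the two P₃'s of a P₄ of G are incompatible on the middle edge of a P₄ of H, so one
-- factor is P₄-free, and a P₄-free component is 2-complete: its universal vertices are shared by
-- the two colour classes.
--
-- Conversely, let the components of G be unions of cliques A, B, and those of H be partitioned
-- into cliques X, Y nested by neighbourhoods. Edges over X × Y point to Y exactly when both
-- G-coordinates lie in B; edges over X enter B, edges over Y enter A, and the remaining ones
-- follow inclusion of closed neighbourhoods in H.

module Submission where

open import Defs
open import Level using (0ℓ)
open import Data.Bool.Base using (Bool; true; false; T; not; _∨_)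
open import Data.Bool.Properties using (T-irrelevant; T-≡; T-∨; T-not-≡; ¬-not) renaming (_≟_ to _≟ᵇ_)
open import Data.Empty using (⊥; ⊥-elim)
open import Data.Fin.Base using (Fin; zero; suc; punchIn; fromℕ<) renaming (_<_ to _<ᶠ_)
open import Data.Fin.Permutation using (Permutation; _⟨$⟩ʳ_; insert; insert-punchIn) renaming (id to idᵖ)
open import Data.Fin.Properties using (any?) renaming (<-asym to <ᶠ-asym; <-cmp to <ᶠ-cmp)
open import Data.List.Base using (List; []; _∷_; map; allFin)
open import Data.List.Membership.Propositional using () renaming (_∈_ to _∈ˡ_)
open import Data.List.Membership.Propositional.Properties using (∈-map⁺; ∈-allFin)
open import Data.List.Relation.Unary.Any using (here; there)
open import Data.Nat.Base using (ℕ; _≤_; z≤n; s≤s)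
open import Data.Nat.Properties using (<-≤-trans)
open import Data.Product.Base using (Σ; ∃; _×_; _,_; proj₁; proj₂; swap)
open import Data.Sum.Base using (_⊎_; inj₁; inj₂; [_,_]′)
open import Data.Unit.Base using (⊤; tt)
open import Function.Base using (_∘_; id)
open import Function.Bundles using (_⇔_; _↔_; mk⇔; Equivalence; Inverse; Injection)
open import Function.Construct.Composition using (_↔-∘_)
open import Function.Properties.Inverse using (↔-sym; ↔⇒↣)
open import Relation.Binary.Construct.Closure.ReflexiveTransitive using (Star; ε; _◅_; _◅◅_; reverse)
open import Relation.Binary.Core using (Rel)
open import Relation.Binary.Definitions using (Decidable; Reflexive; Symmetric; Transitive; Total; tri<; tri≈; tri>)
open import Relation.Binary.PropositionalEquality.Core using (_≡_; _≢_; refl; sym; trans; cong; subst; subst₂; ≢-sym)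
open import Relation.Nullary.Decidable using (Dec; yes; no; ⌊_⌋; _×-dec_; _⊎-dec_; ¬?; toWitness; fromWitness; decidable-stable)
open import Relation.Nullary.Negation using (¬_; contradiction)
open import Relation.Unary using (Pred) renaming (Decidable to Decidable₁)

-- Finite search and sorting.

≢∧≢⇒≡ : ∀ {a b c : Bool} → a ≢ b → c ≢ b → a ≡ c
≢∧≢⇒≡ a≢b c≢b = trans (¬-not a≢b) (sym (¬-not c≢b))

Σ-T-≡ : {A : Set} {S : A → Bool} {p q : Σ A (T ∘ S)} → proj₁ p ≡ proj₁ q → p ≡ q
Σ-T-≡ refl = cong (_ ,_) (T-irrelevant _ _)

search : ∀ {A : Set} {n} → A ↔ Fin n → {P : Pred A 0ℓ} → Decidable₁ P → ∃ P ⊎ (∀ a → ¬ P a)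
search e {P} P? with any? (P? ∘ Inverse.from e)
... | yes (i , p) = inj₁ (Inverse.from e i , p)
... | no  ¬p      = inj₂ λ a pa → ¬p (Inverse.to e a , subst P (sym (Inverse.strictlyInverseʳ e a)) pa)

module _ {A : Set} where

  firstOr : {P : Pred A 0ℓ} → Decidable₁ P → A → List A → A
  firstOr P? d []       = d
  firstOr P? d (x ∷ xs) with P? x
  ... | yes _ = x
  ... | no  _ = firstOr P? d xs

  firstOr-satisfies : {P : Pred A 0ℓ} (P? : Decidable₁ P) {d : A} → P d → ∀ xs → P (firstOr P? d xs)
  firstOr-satisfies P? pd []       = pd
  firstOr-satisfies P? pd (x ∷ xs) with P? x
  ... | yes px = px
  ... | no  _  = firstOr-satisfies P? pd xs

  -- Since some listed `x` satisfies `P`, the defaults `d` and `d′` are never reached and may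
  -- differ.
  firstOr-cong : {P Q : Pred A 0ℓ} (P? : Decidable₁ P) (Q? : Decidable₁ Q) {d d′ : A} →
                 (∀ {x} → P x → Q x) → (∀ {x} → Q x → P x) →
                 ∀ {x xs} → x ∈ˡ xs → P x → firstOr P? d xs ≡ firstOr Q? d′ xs
  firstOr-cong P? Q? P⇒Q Q⇒P {xs = y ∷ xs} x∈ px with P? y | Q? y
  ... | yes _  | yes _  = refl
  ... | yes py | no ¬qy = contradiction (P⇒Q py) ¬qy
  ... | no ¬py | yes qy = contradiction (Q⇒P qy) ¬py
  firstOr-cong P? Q? P⇒Q Q⇒P (here refl) px | no ¬py | no _ = contradiction px ¬py
  firstOr-cong P? Q? P⇒Q Q⇒P (there x∈)  px | no _   | no _ = firstOr-cong P? Q? P⇒Q Q⇒P x∈ px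

minimum : ∀ {n} {_≼_ : Rel (Fin (ℕ.suc n)) 0ℓ} → Total _≼_ → Transitive _≼_ → ∃ λ m → ∀ i → m ≼ i
minimum {ℕ.zero}  total ≼-trans = zero , λ { zero → [ id , id ]′ (total zero zero) }
minimum {ℕ.suc n} total ≼-trans
  with minimum (λ i j → total (suc i) (suc j)) ≼-trans
... | m , m≼ with total zero (suc m)
...   | inj₁ 0≼m = zero , λ { zero → [ id , id ]′ (total zero zero) ; (suc i) → ≼-trans 0≼m (m≼ i) }
...   | inj₂ m≼0 = suc m , λ { zero → m≼0 ; (suc i) → m≼ i }

-- Selection sort: `insert zero m π` puts the minimum `m` in front and lets `π` arrange the other
-- indices, numbered through `punchIn m`.
sorting-permutation : ∀ {n} {_≼_ : Rel (Fin n) 0ℓ} → Total _≼_ → Transitive _≼_ →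
                      ∃ λ (π : Permutation n n) → ∀ {i j} → i <ᶠ j → (π ⟨$⟩ʳ i) ≼ (π ⟨$⟩ʳ j)
sorting-permutation {ℕ.zero}  total ≼-trans = idᵖ , λ { {()} }
sorting-permutation {ℕ.suc n} {_≼_} total ≼-trans
  with minimum total ≼-trans
... | m , m≼ with sorting-permutation (λ i j → total (punchIn m i) (punchIn m j)) ≼-trans
...   | π , sorted = insert zero m π , sorted′
  where
  sorted′ : ∀ {i j} → i <ᶠ j → (insert zero m π ⟨$⟩ʳ i) ≼ (insert zero m π ⟨$⟩ʳ j)
  sorted′ {zero}  {_}     _         = m≼ _
  sorted′ {suc i} {suc j} (s≤s i<j)
    rewrite insert-punchIn zero m π i | insert-punchIn zero m π j = sorted i<j

-- Closed adjacency, reachability and canonical representatives.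

module ClosedAdjacency (G : Graph) where
  open Graph G

  infix 4 _∼_ _≁_ _⊑_

  _∼_ _≁_ : Rel V 0ℓ
  u ∼ v = v ∈N[ u ]
  u ≁ v = ¬ u ∼ v

  _∼?_ : Decidable _∼_
  u ∼? v = v ∈N[ u ]?

  ∼-refl : Reflexive _∼_
  ∼-refl = inj₁ refl

  ∼-sym : Symmetric _∼_
  ∼-sym (inj₁ eq) = inj₁ (sym eq)
  ∼-sym (inj₂ a)  = inj₂ (adj-sym a)

  ∼∧≢⇒adj : ∀ {u v} → u ∼ v → u ≢ v → Adj u v
  ∼∧≢⇒adj (inj₁ eq) u≢v = contradiction (sym eq) u≢v
  ∼∧≢⇒adj (inj₂ a)  _   = a

  _⊑_ : Rel V 0ℓ
  u ⊑ v = ∀ {w} → u ∼ w → v ∼ w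

  ⊑-or-witness : ∀ u v → u ⊑ v ⊎ ∃ λ w → u ∼ w × v ≁ w
  ⊑-or-witness u v with search enum (λ w → (u ∼? w) ×-dec ¬? (v ∼? w))
  ... | inj₁ found = inj₂ found
  ... | inj₂ none  = inj₁ λ {w} u∼w → decidable-stable (v ∼? w) λ v≁w → none w (u∼w , v≁w)

  -- Distinctness is implied: if two of the vertices coincided, a required non-edge would contradict
  -- a required edge or reflexivity of `∼`. The same holds for `InducedP₄`.
  InducedP₃ : Set
  InducedP₃ = ∃ λ a → ∃ λ b → ∃ λ c → a ∼ b × b ∼ c × a ≁ c

  InducedP₄ : Set
  InducedP₄ = ∃ λ w → ∃ λ x → ∃ λ y → ∃ λ z →
    w ∼ x × x ∼ y × y ∼ z × w ≁ y × x ≁ z × w ≁ z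

  ∃? : {P : V → Set} → Decidable₁ P → Dec (∃ P)
  ∃? P? with search enum P?
  ... | inj₁ found = yes found
  ... | inj₂ none  = no λ (a , pa) → none a pa

  inducedP₃? : Dec InducedP₃
  inducedP₃? = ∃? λ a → ∃? λ b → ∃? λ c → (a ∼? b) ×-dec (b ∼? c) ×-dec ¬? (a ∼? c)

  inducedP₄? : Dec InducedP₄
  inducedP₄? = ∃? λ w → ∃? λ x → ∃? λ y → ∃? λ z →
    (w ∼? x) ×-dec (x ∼? y) ×-dec (y ∼? z) ×-dec ¬? (w ∼? y) ×-dec ¬? (x ∼? z) ×-dec ¬? (w ∼? z)

  infix 4 _⋆_

  _⋆_ : Rel V 0ℓ
  _⋆_ = Star Adj

  ⋆-sym : Symmetric _⋆_
  ⋆-sym = reverse adj-sym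

  ∼⇒⋆ : ∀ {u v} → u ∼ v → u ⋆ v
  ∼⇒⋆ (inj₁ refl) = ε
  ∼⇒⋆ (inj₂ a)    = a ◅ ε

  component-connected : ∀ {C} → IsComponent G C → ∀ {u v} → u ∈ C → v ∈ C → u ⋆ v
  component-connected (r , r⋆) {u} {v} u∈ v∈ =
    ⋆-sym (Equivalence.to (r⋆ u) u∈) ◅◅ Equivalence.to (r⋆ v) v∈

module Reachability (G : Graph) where
  open Graph G
  open ClosedAdjacency G

  -- Warshall's algorithm: walks whose inner vertices come from the list.
  Via : List V → Rel V 0ℓ
  Via []       u v = u ∼ v
  Via (x ∷ xs) u v = Via xs u v ⊎ Via xs u x × Via xs x v

  via? : ∀ xs → Decidable (Via xs)
  via? []       u v = u ∼? v
  via? (x ∷ xs) u v = via? xs u v ⊎-dec (via? xs u x ×-dec via? xs x v)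

  ∼⇒via : ∀ xs {u v} → u ∼ v → Via xs u v
  ∼⇒via []       u∼v = u∼v
  ∼⇒via (x ∷ xs) u∼v = inj₁ (∼⇒via xs u∼v)

  via⇒⋆ : ∀ xs {u v} → Via xs u v → u ⋆ v
  via⇒⋆ []       p              = ∼⇒⋆ p
  via⇒⋆ (x ∷ xs) (inj₁ p)       = via⇒⋆ xs p
  via⇒⋆ (x ∷ xs) (inj₂ (p , q)) = via⇒⋆ xs p ◅◅ via⇒⋆ xs q

  -- If both walks visit the pivot `x`, the stretch between the two visits is cut out.
  via-join : ∀ {xs u v y} → y ∈ˡ xs → Via xs u y → Via xs y v → Via xs u v
  via-join (here refl) p q = inj₂ ([ id , proj₁ ]′ p , [ id , proj₂ ]′ q)
  via-join (there y∈) (inj₁ uy)        (inj₁ yv)        = inj₁ (via-join y∈ uy yv)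
  via-join (there y∈) (inj₁ uy)        (inj₂ (yx , xv)) = inj₂ (via-join y∈ uy yx , xv)
  via-join (there y∈) (inj₂ (ux , xy)) (inj₁ yv)        = inj₂ (ux , via-join y∈ xy yv)
  via-join (there y∈) (inj₂ (ux , _))  (inj₂ (_ , xv))  = inj₂ (ux , xv)

  vertices : List V
  vertices = map (Inverse.from enum) (allFin order)

  ∈-vertices : ∀ v → v ∈ˡ vertices
  ∈-vertices v = subst (_∈ˡ vertices) (Inverse.strictlyInverseʳ enum v)
                   (∈-map⁺ (Inverse.from enum) (∈-allFin (Inverse.to enum v)))

  ⋆⇒via : ∀ {u v} → u ⋆ v → Via vertices u v
  ⋆⇒via ε       = ∼⇒via vertices ∼-refl
  ⋆⇒via (a ◅ p) = via-join (∈-vertices _) (∼⇒via vertices (inj₂ a)) (⋆⇒via p)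

  _⋆?_ : Decidable _⋆_
  u ⋆? v with via? vertices u v
  ... | yes p = yes (via⇒⋆ vertices p)
  ... | no ¬p = no (¬p ∘ ⋆⇒via)

  component : V → VertexSet
  component r v = ⌊ r ⋆? v ⌋

  ⋆⇒∈ : ∀ {r v} → r ⋆ v → v ∈ component r
  ⋆⇒∈ {r} {v} = fromWitness {a? = r ⋆? v}

  component-isComponent : ∀ r → IsComponent G (component r)
  component-isComponent r = r , λ v → mk⇔ (toWitness {a? = r ⋆? v}) ⋆⇒∈

  -- Taking the first reachable vertex of a fixed enumeration gives connected vertices equal roots,
  -- so that data chosen per root agree on a component.
  representative : V → V
  representative u = firstOr (u ⋆?_) u vertices

  ∈-representative : ∀ u → u ∈ component (representative u)
  ∈-representative u = ⋆⇒∈ (⋆-sym (firstOr-satisfies (u ⋆?_) ε vertices))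

  representative-cong : ∀ {u v} → u ⋆ v → representative u ≡ representative v
  representative-cong {u} {v} u⋆v =
    firstOr-cong (u ⋆?_) (v ⋆?_) (⋆-sym u⋆v ◅◅_) (u⋆v ◅◅_) (∈-vertices v) u⋆v

  glue : (∀ r → Σ V (_∈ component r) → Bool) → V → Bool
  glue S u = S (representative u) (u , ∈-representative u)

  ⋆⇒∈-representative : ∀ {u v} → u ⋆ v → v ∈ component (representative u)
  ⋆⇒∈-representative u⋆v = subst (λ r → _ ∈ component r) (sym (representative-cong u⋆v)) (∈-representative _)

  glue-⋆ : ∀ S {u v} (u⋆v : u ⋆ v) → glue S v ≡ S (representative u) (v , ⋆⇒∈-representative u⋆v)
  glue-⋆ S {v = v} u⋆v = at (sym (representative-cong u⋆v)) _
    where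
    -- The root is made a variable so that the equation of roots can be matched; only the membership
    -- proofs then differ.
    at : ∀ {r} → representative v ≡ r → (v∈ : v ∈ component r) → glue S v ≡ S r (v , v∈)
    at refl v∈ = cong (S _) (Σ-T-≡ refl)

-- Component structure from forbidden paths and from colourings.

complete-components⇒∼-trans : ∀ G → EveryComponent Complete G → Transitive (ClosedAdjacency._∼_ G)
complete-components⇒∼-trans G comps {a} {b} {c} a∼b b∼c with Graph._≟ⱽ_ G c a
... | yes c≡a = inj₁ c≡a
... | no  c≢a = inj₂ (comps (component a) (component-isComponent a)
                        {a , ⋆⇒∈ ε} {c , ⋆⇒∈ (∼⇒⋆ a∼b ◅◅ ∼⇒⋆ b∼c)} λ eq → c≢a (sym (cong proj₁ eq)))
  where
  open ClosedAdjacency G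
  open Reachability G

-- A walk collapses from its far end: by induction its tail has closed-adjacent ends, and one more
-- step would otherwise create an induced P₃.
P₃-free⇒complete-components : ∀ G → ¬ ClosedAdjacency.InducedP₃ G → EveryComponent Complete G
P₃-free⇒complete-components G noP₃ C isC {u , u∈} {v , v∈} u≢v =
  ∼∧≢⇒adj (⋆⇒∼ (component-connected isC u∈ v∈)) (u≢v ∘ Σ-T-≡)
  where
  open ClosedAdjacency G
  ⋆⇒∼ : ∀ {u v} → u ⋆ v → u ∼ v
  ⋆⇒∼ ε = ∼-refl
  ⋆⇒∼ {u} {v} (a ◅ p) =
    decidable-stable (u ∼? v) λ u≁v → noP₃ (u , _ , v , inj₂ a , ⋆⇒∼ p , u≁v)

-- Mentions a single graph only, so that the consequences below serve either factor of the product.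
record SeparatingColouring (G : Graph) : Set where
  open Graph G
  open ClosedAdjacency G
  field
    colour      : V → Bool
    distance₂-≢ : ∀ {x y z} → x ∼ y → y ∼ z → x ≁ z → colour x ≢ colour z
    P₄-middle-≢ : ∀ {w x y z} → w ∼ x → x ∼ y → y ∼ z → w ≁ y → x ≁ z → w ≁ z → colour x ≢ colour y
    C₄-free     : ∀ {w x y z} → w ∼ x → x ∼ y → y ∼ z → z ∼ w → w ≁ y → ¬ x ≁ z

  -- `w` and `x` both differ from `y`, hence agree; and `x` differs from `z`.
  P₄-ends-≢ : ∀ {w x y z} → w ∼ x → x ∼ y → y ∼ z → w ≁ y → x ≁ z → w ≁ z → colour w ≢ colour z
  P₄-ends-≢ w∼x x∼y y∼z w≁y x≁z w≁z cw≡cz =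
    distance₂-≢ x∼y y∼z x≁z
      (trans (≢∧≢⇒≡ (P₄-middle-≢ w∼x x∼y y∼z w≁y x≁z w≁z) (distance₂-≢ w∼x x∼y w≁y)) cw≡cz)

  data Within₃ (u v : V) : Set where
    near  : u ∼ v → Within₃ u v
    endP₃ : ∀ {x} → u ∼ x → x ∼ v → u ≁ v → Within₃ u v
    endP₄ : ∀ {x y} → u ∼ x → x ∼ y → y ∼ v → u ≁ y → x ≁ v → u ≁ v → Within₃ u v

  -- An induced P₅ cannot be coloured, so no distance exceeds 3.
  within₃-step : ∀ {u v v′} → Within₃ u v → v ∼ v′ → Within₃ u v′
  within₃-step {u} {v} {v′} d v∼v′ with u ∼? v′
  ... | yes u∼v′ = near u∼v′
  ... | no  u≁v′ with d
  ...   | near u∼v = endP₃ u∼v v∼v′ u≁v′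
  ...   | endP₃ {x} u∼x x∼v u≁v with x ∼? v′
  ...     | yes x∼v′ = endP₃ u∼x x∼v′ u≁v′
  ...     | no  x≁v′ = endP₄ u∼x x∼v v∼v′ u≁v x≁v′ u≁v′
  within₃-step {u} {v} {v′} d v∼v′ | no u≁v′ | endP₄ {x} {y} u∼x x∼y y∼v u≁y x≁v u≁v with x ∼? v′ | y ∼? v′
  ... | yes x∼v′ | _        = endP₃ u∼x x∼v′ u≁v′
  ... | no  x≁v′ | yes y∼v′ = endP₄ u∼x x∼y y∼v′ u≁y x≁v′ u≁v′
  -- The P₄'s `u x y v` and `x y v v′` make both `x` and `v` differ from `y`, so these agree
  -- although they are at distance 2.
  ... | no  x≁v′ | no  y≁v′ = contradiction
    (≢∧≢⇒≡ (P₄-middle-≢ u∼x x∼y y∼v u≁y x≁v u≁v)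
            (≢-sym (P₄-middle-≢ x∼y y∼v v∼v′ x≁v y≁v′ x≁v′)))
    (distance₂-≢ x∼y y∼v x≁v)

  within₃-⋆ : ∀ {u v w} → Within₃ u v → v ⋆ w → Within₃ u w
  within₃-⋆ d ε       = d
  within₃-⋆ d (a ◅ p) = within₃-⋆ (within₃-step d (inj₂ a)) p

  -- By `Within₃`, non-adjacent vertices of one component are the ends of an induced P₃ or P₄, and
  -- such ends differ in colour.
  monochromatic⇒∼ : ∀ {u v} → u ⋆ v → colour u ≡ colour v → u ∼ v
  monochromatic⇒∼ p eq with within₃-⋆ (near ∼-refl) p
  ... | near u∼v                         = u∼v
  ... | endP₃ u∼x x∼v u≁v                = contradiction eq (distance₂-≢ u∼x x∼v u≁v)
  ... | endP₄ u∼x x∼y y∼v u≁y x≁v u≁v = contradiction eq (P₄-ends-≢ u∼x x∼y y∼v u≁y x≁v u≁v)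

  -- Private neighbours `s` of `u` and `t` of `v` both avoid the common colour, so they are adjacent
  -- and `s u v t` is an induced C₄.
  ⊑-total : ∀ {u v} → u ⋆ v → colour u ≡ colour v → u ⊑ v ⊎ v ⊑ u
  ⊑-total {u} {v} p eq with ⊑-or-witness u v | ⊑-or-witness v u
  ... | inj₁ u⊑v | _        = inj₁ u⊑v
  ... | inj₂ _   | inj₁ v⊑u = inj₂ v⊑u
  ... | inj₂ (s , u∼s , v≁s) | inj₂ (t , v∼t , u≁t) =
    ⊥-elim (C₄-free (∼-sym u∼s) u∼v v∼t t∼s (v≁s ∘ ∼-sym) u≁t)
    where
    u∼v = monochromatic⇒∼ p eq
    t∼s = monochromatic⇒∼ (∼⇒⋆ (∼-sym v∼t) ◅◅ (⋆-sym p ◅◅ ∼⇒⋆ u∼s))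
            (≢∧≢⇒≡ (≢-sym (subst (_≢ colour t) eq (distance₂-≢ u∼v v∼t u≁t)))
                    (≢-sym (distance₂-≢ (∼-sym u∼v) u∼s v≁s)))

  -- On a colour class of a component `⊑` is a total preorder; sorting by it yields the nested
  -- ordering.
  cochain-components : EveryComponent CoChain G
  cochain-components C isC = record
    { X        = X
    ; Y        = not ∘ X
    ; cover    = λ v → cover (X v)
    ; disjoint = λ v → disjoint (X v)
    ; X-clique = λ {u} {v} u∈ v∈ → clique (trans (to T-≡ u∈) (sym (to T-≡ v∈)))
    ; Y-clique = λ {u} {v} u∈ v∈ → clique (trans (to T-not-≡ u∈) (sym (to T-not-≡ v∈)))
    ; size     = Graph.order KX
    ; ordering = ↔-sym (Graph.enum KX) ↔-∘ proj₁ sorted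
    ; nested   = λ i<j → ⊑⇒nested (proj₂ sorted i<j)
    }
    where
    open Equivalence using (to)

    K = induced G C
    X : Graph.VertexSet K
    X (v , _) = colour v
    KX = induced K X

    cover : ∀ b → T b ⊎ T (not b)
    cover true  = inj₁ tt
    cover false = inj₂ tt

    disjoint : ∀ b → ¬ (T b × T (not b))
    disjoint true  (_ , ())
    disjoint false (() , _)

    connected : (u v : Graph.V K) → proj₁ u ⋆ proj₁ v
    connected (_ , u∈) (_ , v∈) = component-connected isC u∈ v∈

    clique : ∀ {u v : Graph.V K} → X u ≡ X v → u ≢ v → Graph.Adj K u v
    clique {u} {v} eq u≢v = ∼∧≢⇒adj (monochromatic⇒∼ (connected u v) eq) (u≢v ∘ Σ-T-≡)

    vertex : Fin (Graph.order KX) → Graph.V K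
    vertex i = proj₁ (Inverse.from (Graph.enum KX) i)

    vertex-colour : ∀ i → X (vertex i) ≡ true
    vertex-colour i = to T-≡ (proj₂ (Inverse.from (Graph.enum KX) i))

    _≼_ : Rel (Fin (Graph.order KX)) 0ℓ
    i ≼ j = proj₁ (vertex i) ⊑ proj₁ (vertex j)

    sorted : ∃ λ (π : Permutation (Graph.order KX) (Graph.order KX)) →
               ∀ {i j} → i <ᶠ j → (π ⟨$⟩ʳ i) ≼ (π ⟨$⟩ʳ j)
    sorted = sorting-permutation {_≼_ = _≼_}
      (λ i j → ⊑-total (connected (vertex i) (vertex j)) (trans (vertex-colour i) (sym (vertex-colour j))))
      (λ {i} {j} {k} i≼j j≼k → j≼k ∘ i≼j)

    ⊑⇒nested : ∀ {u v : Graph.V K} → proj₁ u ⊑ proj₁ v →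
               ∀ {w} → Graph._∈N[_] K w u → Graph._∈N[_] K w v
    ⊑⇒nested u⊑v w∈ with u⊑v ([ inj₁ ∘ cong proj₁ , inj₂ ]′ w∈)
    ... | inj₁ eq = inj₁ (Σ-T-≡ eq)
    ... | inj₂ a  = inj₂ a

  -- Without P₄ every bichromatic edge has a universal end, so adding the universal vertices to both
  -- colour classes places each edge inside one of them.
  two-complete-components : ¬ InducedP₄ → EveryComponent TwoComplete G
  two-complete-components noP₄ C isC@(r , r⋆) = record
    { A      = A
    ; B      = B
    ; cover  = cover
    ; edges  = λ u v → mk⇔
        (λ a → (λ { refl → adj-irrefl refl a }) , edge⇒ u v a)
        (λ (u≢v , uv∈) → ∼∧≢⇒adj (edge⇐ u v uv∈) (u≢v ∘ Σ-T-≡))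
    ; shared = shared
    }
    where
    open Equivalence using (to; from)

    K = induced G C
    open Graph K using () renaming (V to Vᴷ)

    connected : (u v : Vᴷ) → proj₁ u ⋆ proj₁ v
    connected (_ , u∈) (_ , v∈) = component-connected isC u∈ v∈

    Universal : Vᴷ → Set
    Universal u = ∀ (v : Vᴷ) → proj₁ u ∼ proj₁ v

    universal-or-witness : ∀ u → Universal u ⊎ ∃ λ (v : Vᴷ) → proj₁ u ≁ proj₁ v
    universal-or-witness u with search (Graph.enum K) (λ v → ¬? (proj₁ u ∼? proj₁ v))
    ... | inj₁ found = inj₂ found
    ... | inj₂ none  = inj₁ λ v → decidable-stable (proj₁ u ∼? proj₁ v) (none v)

    universal? : ∀ u → Dec (Universal u)
    universal? u with universal-or-witness u
    ... | inj₁ univ      = yes univ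
    ... | inj₂ (v , u≁v) = no λ univ → u≁v (univ v)

    A B : Vᴷ → Bool
    A u = colour (proj₁ u) ∨ ⌊ universal? u ⌋
    B u = not (colour (proj₁ u)) ∨ ⌊ universal? u ⌋

    universal⇒A : ∀ u → Universal u → T (A u)
    universal⇒A u univ = from (T-∨ {colour (proj₁ u)}) (inj₂ (fromWitness {a? = universal? u} univ))

    universal⇒B : ∀ u → Universal u → T (B u)
    universal⇒B u univ = from (T-∨ {not (colour (proj₁ u))}) (inj₂ (fromWitness {a? = universal? u} univ))

    true⇒A : ∀ u → colour (proj₁ u) ≡ true → T (A u)
    true⇒A u eq = from T-∨ (inj₁ (from T-≡ eq))

    false⇒B : ∀ u → colour (proj₁ u) ≡ false → T (B u)
    false⇒B u eq = from T-∨ (inj₁ (from T-not-≡ eq))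

    cover : ∀ u → T (A u) ⊎ T (B u)
    cover u with colour (proj₁ u)
    ... | true  = inj₁ tt
    ... | false = inj₂ tt

    nonadjacent⇒≢ : ∀ (u v : Vᴷ) → proj₁ u ≁ proj₁ v → colour (proj₁ u) ≢ colour (proj₁ v)
    nonadjacent⇒≢ u v u≁v eq = u≁v (monochromatic⇒∼ (connected u v) eq)

    -- Otherwise non-neighbours of the two ends complete the edge to an induced P₄ or C₄.
    bichromatic-edge : ∀ (u v : Vᴷ) → proj₁ u ∼ proj₁ v → colour (proj₁ u) ≢ colour (proj₁ v) →
                       Universal u ⊎ Universal v
    bichromatic-edge u v u∼v c≢ with universal-or-witness u | universal-or-witness v
    ... | inj₁ univ | _         = inj₁ univ
    ... | inj₂ _    | inj₁ univ = inj₂ univ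
    ... | inj₂ (s , u≁s) | inj₂ (t , v≁t) =
      ⊥-elim (noP₄ (_ , _ , _ , _ , s∼v , ∼-sym u∼v , u∼t , u≁s ∘ ∼-sym , v≁t , s≁t))
      where
      s∼v = monochromatic⇒∼ (connected s v) (≢∧≢⇒≡ (≢-sym (nonadjacent⇒≢ u s u≁s)) (≢-sym c≢))
      u∼t = monochromatic⇒∼ (connected u t) (≢∧≢⇒≡ c≢ (≢-sym (nonadjacent⇒≢ v t v≁t)))

      s≁t : proj₁ s ≁ proj₁ t
      s≁t s∼t = C₄-free s∼v (∼-sym u∼v) u∼t (∼-sym s∼t) (u≁s ∘ ∼-sym) v≁t

    edge⇒ : ∀ u v → Graph.Adj K u v → (T (A u) × T (A v)) ⊎ (T (B u) × T (B v))
    edge⇒ u v a with colour (proj₁ u) ≟ᵇ colour (proj₁ v)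
    ... | no c≢ with bichromatic-edge u v (inj₂ a) c≢
    ...   | inj₁ univ = [ (λ v∈ → inj₁ (universal⇒A u univ , v∈)) , (λ v∈ → inj₂ (universal⇒B u univ , v∈)) ]′ (cover v)
    ...   | inj₂ univ = [ (λ u∈ → inj₁ (u∈ , universal⇒A v univ)) , (λ u∈ → inj₂ (u∈ , universal⇒B v univ)) ]′ (cover u)
    edge⇒ u v a | yes c≡ = by-colour _ refl
      where
      by-colour : ∀ b → colour (proj₁ u) ≡ b → (T (A u) × T (A v)) ⊎ (T (B u) × T (B v))
      by-colour true  eq = inj₁ (true⇒A u eq , true⇒A v (trans (sym c≡) eq))
      by-colour false eq = inj₂ (false⇒B u eq , false⇒B v (trans (sym c≡) eq))

    edge⇐ : ∀ u v → (T (A u) × T (A v)) ⊎ (T (B u) × T (B v)) → proj₁ u ∼ proj₁ v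
    edge⇐ u v uv∈ with universal? u | universal? v
    ... | yes univ | _        = univ v
    ... | no _     | yes univ = ∼-sym (univ u)
    ... | no _     | no _     = monochromatic⇒∼ (connected u v) ([ both-A , both-B ]′ uv∈)
      where
      both-A : T (colour (proj₁ u) ∨ false) × T (colour (proj₁ v) ∨ false) → _
      both-A (u∈ , v∈) = trans (to T-≡ ([ id , (λ ()) ]′ (to T-∨ u∈))) (sym (to T-≡ ([ id , (λ ()) ]′ (to T-∨ v∈))))
      both-B : T (not (colour (proj₁ u)) ∨ false) × T (not (colour (proj₁ v)) ∨ false) → _
      both-B (u∈ , v∈) = trans (to T-not-≡ ([ id , (λ ()) ]′ (to T-∨ u∈))) (sym (to T-not-≡ ([ id , (λ ()) ]′ (to T-∨ v∈))))

    -- Somewhere the walk changes colour, and the edge where it does has a universal end.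
    universal-between : ∀ {u v} → u ⋆ v → u ∈ C → colour u ≢ colour v → ∃ Universal
    universal-between ε u∈ c≢ = contradiction refl c≢
    universal-between {u} (_◅_ {j = w} a p) u∈ c≢ with colour u ≟ᵇ colour w
    ... | yes c≡  = universal-between p (from (r⋆ w) (to (r⋆ u) u∈ ◅◅ (a ◅ ε))) (c≢ ∘ trans c≡)
    ... | no  c≢′ = [ (u′ ,_) , (w′ ,_) ]′ (bichromatic-edge u′ w′ (inj₂ a) c≢′)
      where
      u′ w′ : Vᴷ
      u′ = u , u∈
      w′ = w , from (r⋆ w) (to (r⋆ u) u∈ ◅◅ (a ◅ ε))

    ∃-universal : ∃ Universal
    ∃-universal with universal-or-witness (r , from (r⋆ r) ε)
    ... | inj₁ univ      = (r , from (r⋆ r) ε) , univ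
    ... | inj₂ (v , r≁v) =
      universal-between (to (r⋆ _) (proj₂ v)) (from (r⋆ r) ε) (nonadjacent⇒≢ (r , from (r⋆ r) ε) v r≁v)

    shared : ∃ λ v → T (A v) × T (B v)
    shared with ∃-universal
    ... | v , univ = v , universal⇒A v univ , universal⇒B v univ

-- Symmetry and fibres of the strong product.

⊠-comm : ∀ G H → OnePerfectlyOrientable (G ⊠ H) → OnePerfectlyOrientable (H ⊠ G)
⊠-comm G H (D , perfect) = record
  { _⟶_    = λ p q → swap p ⟶ swap q
  ; ⟶⇒adj  = swap-adj G H ∘ ⟶⇒adj
  ; orient = orient ∘ swap-adj H G
  ; asym   = asym
  } , λ p⟶q p⟶r q≢r → swap-adj G H (perfect p⟶q p⟶r (q≢r ∘ cong swap))
  where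
  open Orientation D
  swap-adj : ∀ G H {p q} → Graph.Adj (G ⊠ H) p q → Graph.Adj (H ⊠ G) (swap p) (swap q)
  swap-adj G H (p≢q , u∼ , v∼) = p≢q ∘ cong swap , v∼ , u∼

-- The fibre over `g` is an induced copy of `H`, and 1-perfection passes to induced subgraphs.
⊠-factor : ∀ G H → Graph.V G → OnePerfectlyOrientable (G ⊠ H) → OnePerfectlyOrientable H
⊠-factor G H g (D , perfect) = record
  { _⟶_    = λ u v → (g , u) ⟶ (g , v)
  ; ⟶⇒adj  = fibre-adj ∘ ⟶⇒adj
  ; orient = λ a → orient ((λ { refl → Graph.adj-irrefl H refl a }) , inj₁ refl , inj₂ a)
  ; asym   = asym
  } , λ u⟶v u⟶w v≢w → fibre-adj (perfect u⟶v u⟶w (v≢w ∘ cong proj₂))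
  where
  open Orientation D
  fibre-adj : ∀ {u v} → Graph.Adj (G ⊠ H) (g , u) (g , v) → Graph.Adj H u v
  fibre-adj (p≢q , _ , u∼v) = ClosedAdjacency.∼∧≢⇒adj H u∼v (p≢q ∘ cong (g ,_))

-- Colourings of one factor from an orientation and a path in the other.

module _ (G H : Graph) (D : Orientation (G ⊠ H)) (perfect : OnePerfect (G ⊠ H) D) where
  open Orientation D
  open ClosedAdjacency H
  private
    module G  = Graph G
    module GC = ClosedAdjacency G
    module H  = Graph H
    module P  = Graph (G ⊠ H)

  -- Used in reverse: two arcs from one vertex cannot reach coordinates related by `≁`.
  out-∼ : ∀ {p q r} → p ⟶ q → p ⟶ r → proj₁ q GC.∼ proj₁ r × proj₂ q ∼ proj₂ r
  out-∼ {p} {q} {r} p⟶q p⟶r with q P.≟ⱽ r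
  ... | yes refl = GC.∼-refl , ∼-refl
  ... | no  q≢r  = proj₂ (perfect p⟶q p⟶r q≢r)

  -- Decidability is recovered from `adj?`, `orient` and `asym`; the search in `dominated` relies on
  -- it.
  ⟶-dec : Decidable _⟶_
  ⟶-dec p q with P.adj? p q
  ... | no  ¬a = no (¬a ∘ ⟶⇒adj)
  ... | yes a with orient a
  ...   | inj₁ p⟶q = yes p⟶q
  ...   | inj₂ q⟶p = no (asym q⟶p)

  module _ {a b c} (a∼b : a GC.∼ b) (b∼c : b GC.∼ c) (a≁c : a GC.≁ c) where

    end : Bool → G.V
    end true  = a
    end false = c

    end∼b : ∀ e → end e GC.∼ b
    end∼b true  = a∼b
    end∼b false = GC.∼-sym b∼c

    end≢b : ∀ e → end e ≢ b
    end≢b true  refl = a≁c b∼c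
    end≢b false refl = a≁c a∼b

    DominatedBy : Bool → H.V → Set
    DominatedBy e y = ∀ y′ → y ∼ y′ → (end e , y′) ⟶ (b , y)

    -- A single missing arc from the fibre over `a` means `(b , y) ⟶ (a , y₀)`, which bars `(b , y)`
    -- from every vertex over `c`.
    dominated : ∀ y → ∃ λ e → DominatedBy e y
    dominated y with search H.enum (λ y′ → (y ∼? y′) ×-dec ¬? (⟶-dec (a , y′) (b , y)))
    ... | inj₂ none = true , λ y′ y∼y′ → decidable-stable (⟶-dec _ _) λ ¬⟶ → none y′ (y∼y′ , ¬⟶)
    ... | inj₁ (y₀ , y∼y₀ , ¬⟶) = false , from-c
      where
      spoke : ∀ e {y′} → y ∼ y′ → (end e , y′) ⟶ (b , y) ⊎ (b , y) ⟶ (end e , y′)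
      spoke e y∼y′ = orient (end≢b e ∘ cong proj₁ , end∼b e , ∼-sym y∼y′)

      from-c : DominatedBy false y
      from-c y′ y∼y′ with spoke false y∼y′ | spoke true y∼y₀
      ... | inj₁ c⟶b | _        = c⟶b
      ... | inj₂ _   | inj₁ a⟶b = contradiction a⟶b ¬⟶
      ... | inj₂ b⟶c | inj₂ b⟶a = contradiction (proj₁ (out-∼ b⟶a b⟶c)) a≁c

    endColour : H.V → Bool
    endColour y = proj₁ (dominated y)

    end⟶b : ∀ {y y′} → y ∼ y′ → (end (endColour y) , y′) ⟶ (b , y)
    end⟶b {y} {y′} = proj₂ (dominated y) y′

    endColour-distance₂ : ∀ {x y z} → x ∼ y → y ∼ z → x ≁ z → endColour x ≢ endColour z
    endColour-distance₂ {x} {y} {z} x∼y y∼z x≁z eq =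
      x≁z (proj₂ (out-∼ (end⟶b x∼y) (subst (λ e → (end e , y) ⟶ (b , z)) (sym eq) (end⟶b (∼-sym y∼z)))))

    -- The arc (e , y) ⟶ (b , x) keeps (e , z) out of the out-clique of (e , y).
    end-fibre : ∀ {x y z} → x ∼ y → y ∼ z → x ≁ z → (end (endColour x) , z) ⟶ (end (endColour x) , y)
    end-fibre {x} x∼y y∼z x≁z
      with orient {end (endColour x) , _} {end (endColour x) , _}
             ((λ { refl → x≁z x∼y }) , GC.∼-refl , ∼-sym y∼z)
    ... | inj₁ z⟶y = z⟶y
    ... | inj₂ y⟶z = contradiction (proj₂ (out-∼ (end⟶b x∼y) y⟶z)) x≁z

    P₃-colouring : SeparatingColouring H
    P₃-colouring = record
      { colour      = endColour
      ; distance₂-≢ = endColour-distance₂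
      ; P₄-middle-≢ = middle
      -- The two paths from `w` to `y` give arcs from `y` to the non-adjacent `x` and `z`, all in
      -- the fibre over the end that colours `w`.
      ; C₄-free     = λ w∼x x∼y y∼z z∼w w≁y x≁z →
          x≁z (proj₂ (out-∼ (end-fibre w∼x x∼y w≁y) (end-fibre (∼-sym z∼w) (∼-sym y∼z) w≁y)))
      }
      where
      middle : ∀ {w x y z} → w ∼ x → x ∼ y → y ∼ z → w ≁ y → x ≁ z → w ≁ z → endColour x ≢ endColour y
      -- If `x` and `y` agreed, so would `w` and `z`; in the fibre over their common end, the path
      -- from `w` and the path from `z` then orient the edge `x y` in opposite ways.
      middle {w} {x} {y} {z} w∼x x∼y y∼z w≁y x≁z w≁z eq = asym (end-fibre w∼x x∼y w≁y)
        (subst (λ e → (end e , x) ⟶ (end e , y)) z≡w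
          (end-fibre (∼-sym y∼z) (∼-sym x∼y) (x≁z ∘ ∼-sym)))
        where
        z≡w : endColour z ≡ endColour w
        z≡w = ≢∧≢⇒≡ (≢-sym (endColour-distance₂ x∼y y∼z x≁z))
                     (subst (endColour w ≢_) (sym eq) (endColour-distance₂ w∼x x∼y w≁y))

  -- Both colourings change along `x y`, so `col₁ u ≡ false` and `col₂ v ≡ true` for some ends `u`,
  -- `v` of that edge. As `u ∼ v`, the pair `(q , u)`, `(r , v)` gets arcs in both directions.
  no-P₄-in-both : GC.InducedP₄ → ¬ InducedP₄
  no-P₄-in-both (p , q , r , s , p∼q , q∼r , r∼s , p≁r , q≁s , _) (w , x , y , z , w∼x , x∼y , y∼z , w≁y , x≁z , w≁z) =
    clash x y x∼y (middle p∼q q∼r p≁r) (middle q∼r r∼s q≁s)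
    where
    col₁ = endColour p∼q q∼r p≁r
    col₂ = endColour q∼r r∼s q≁s

    middle : ∀ {a b c} (a∼b : a GC.∼ b) (b∼c : b GC.∼ c) (a≁c : a GC.≁ c) →
             endColour a∼b b∼c a≁c x ≢ endColour a∼b b∼c a≁c y
    middle a∼b b∼c a≁c =
      SeparatingColouring.P₄-middle-≢ (P₃-colouring a∼b b∼c a≁c) w∼x x∼y y∼z w≁y x≁z w≁z

    arc₁ : ∀ {u v} → u ∼ v → col₁ u ≡ false → (r , v) ⟶ (q , u)
    arc₁ {u} {v} u∼v eq = subst (λ e → (end p∼q q∼r p≁r e , v) ⟶ (q , u)) eq (end⟶b p∼q q∼r p≁r u∼v)

    arc₂ : ∀ {u v} → u ∼ v → col₂ u ≡ true → (q , v) ⟶ (r , u)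
    arc₂ {u} {v} u∼v eq = subst (λ e → (end q∼r r∼s q≁s e , v) ⟶ (r , u)) eq (end⟶b q∼r r∼s q≁s u∼v)

    clash : ∀ x y → x ∼ y → col₁ x ≢ col₁ y → col₂ x ≢ col₂ y → ⊥
    clash x y x∼y c₁ c₂ with col₁ x in x₁ | col₁ y in y₁ | col₂ x in x₂ | col₂ y in y₂
    ... | true  | true  | _     | _     = c₁ refl
    ... | false | false | _     | _     = c₁ refl
    ... | _     | _     | true  | true  = c₂ refl
    ... | _     | _     | false | false = c₂ refl
    ... | true  | false | true  | false = asym (arc₁ (∼-sym x∼y) y₁) (arc₂ x∼y x₂)
    ... | true  | false | false | true  = asym (arc₁ ∼-refl y₁) (arc₂ ∼-refl y₂)
    ... | false | true  | true  | false = asym (arc₁ ∼-refl x₁) (arc₂ ∼-refl x₂)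
    ... | false | true  | false | true  = asym (arc₁ x∼y x₁) (arc₂ (∼-sym x∼y) y₂)

-- From an orientation to the characterisation.

Characterisation : Graph → Graph → Set₁
Characterisation G H =
  ((EveryComponent Complete G × OnePerfectlyOrientable H) ⊎
   (EveryComponent Complete H × OnePerfectlyOrientable G)) ⊎
  ((EveryComponent TwoComplete G × EveryComponent CoChain H) ⊎
   (EveryComponent TwoComplete H × EveryComponent CoChain G))

vertex : ∀ G → 2 ≤ Graph.order G → Graph.V G
vertex G 2≤n = Inverse.from (Graph.enum G) (fromℕ< (<-≤-trans (s≤s z≤n) 2≤n))

-- The P₃ of each factor colours the other, so both factors have co-chain components; it remains to
-- find which one is P₄-free.
orientable⇒two-complete×cochain :
  ∀ G H → ClosedAdjacency.InducedP₃ G → ClosedAdjacency.InducedP₃ H → OnePerfectlyOrientable (G ⊠ H) →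
  (EveryComponent TwoComplete G × EveryComponent CoChain H) ⊎
  (EveryComponent TwoComplete H × EveryComponent CoChain G)
orientable⇒two-complete×cochain G H (_ , _ , _ , a∼b , b∼c , a≁c) (_ , _ , _ , d∼e , e∼f , d≁f) po@(D , perfect) =
  by-P₄ (ClosedAdjacency.inducedP₄? G) (ClosedAdjacency.inducedP₄? H)
  where
  open SeparatingColouring using (two-complete-components; cochain-components)

  colouringH : SeparatingColouring H
  colouringH = P₃-colouring G H D perfect a∼b b∼c a≁c

  colouringG : SeparatingColouring G
  colouringG = P₃-colouring H G (proj₁ (⊠-comm G H po)) (proj₂ (⊠-comm G H po)) d∼e e∼f d≁f

  by-P₄ : Dec (ClosedAdjacency.InducedP₄ G) → Dec (ClosedAdjacency.InducedP₄ H) → _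
  by-P₄ (no noP₄) _         = inj₁ (two-complete-components colouringG noP₄ , cochain-components colouringH)
  by-P₄ (yes _)   (no noP₄) = inj₂ (two-complete-components colouringH noP₄ , cochain-components colouringG)
  by-P₄ (yes p₄)  (yes p₄′) = ⊥-elim (no-P₄-in-both G H D perfect p₄ p₄′)

orientable⇒characterisation : ∀ G H → 2 ≤ Graph.order G → 2 ≤ Graph.order H →
                              OnePerfectlyOrientable (G ⊠ H) → Characterisation G H
orientable⇒characterisation G H 2≤G 2≤H po
  with ClosedAdjacency.inducedP₃? G | ClosedAdjacency.inducedP₃? H
... | no noP₃ | _       = inj₁ (inj₁ (P₃-free⇒complete-components G noP₃ , ⊠-factor G H (vertex G 2≤G) po))
... | yes _   | no noP₃ =
  inj₁ (inj₂ (P₃-free⇒complete-components H noP₃ , ⊠-factor H G (vertex H 2≤H) (⊠-comm G H po)))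
... | yes p₃  | yes p₃′ = inj₂ (orientable⇒two-complete×cochain G H p₃ p₃′ po)

-- Orienting the product when one factor has complete components.

index-total : ∀ G → let open Graph G in ∀ {u v} → u ≢ v →
              Inverse.to enum u <ᶠ Inverse.to enum v ⊎ Inverse.to enum v <ᶠ Inverse.to enum u
index-total G {u} {v} u≢v with <ᶠ-cmp (Inverse.to (Graph.enum G) u) (Inverse.to (Graph.enum G) v)
... | tri< lt _  _  = inj₁ lt
... | tri≈ _  eq _  = contradiction (Injection.injective (↔⇒↣ (Graph.enum G)) eq) u≢v
... | tri> _  _  gt = inj₂ gt

-- Arcs copy `D` in the `H`-coordinate, and the enumeration of `G` orders vertices with equal
-- `H`-coordinate. Transitivity of `∼` handles the `G`-coordinates of out-neighbours.
complete⊠orientable : ∀ G H → EveryComponent Complete G → OnePerfectlyOrientable H → OnePerfectlyOrientable (G ⊠ H)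
complete⊠orientable G H comps (D , perfect) = record
  { _⟶_    = _⟶′_
  ; ⟶⇒adj  = ⟶′⇒adj
  ; orient = orient′
  ; asym   = asym′
  } , λ {p} {q} {r} → perfect′ {p} {q} {r}
  where
  open Orientation D
  open ClosedAdjacency G
  open Inverse (Graph.enum G) using () renaming (to to index)
  module H = Graph H
  module P = Graph (G ⊠ H)

  ∼-trans : Transitive _∼_
  ∼-trans = complete-components⇒∼-trans G comps

  _⟶′_ : Rel P.V 0ℓ
  (u , v) ⟶′ (u′ , v′) = u ∼ u′ × (v ⟶ v′ ⊎ v ≡ v′ × index u <ᶠ index u′)

  ⟶′⇒adj : ∀ {p q} → p ⟶′ q → P.Adj p q
  ⟶′⇒adj (u∼u′ , inj₁ v⟶v′)        =
    (λ { refl → asym v⟶v′ v⟶v′ }) , u∼u′ , inj₂ (⟶⇒adj v⟶v′)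
  ⟶′⇒adj (u∼u′ , inj₂ (refl , lt)) =
    (λ { refl → <ᶠ-asym lt lt }) , u∼u′ , inj₁ refl

  orient′ : ∀ {p q} → P.Adj p q → p ⟶′ q ⊎ q ⟶′ p
  orient′ (p≢q , u∼u′ , inj₁ refl) with index-total G (p≢q ∘ cong (_, _))
  ... | inj₁ lt = inj₁ (u∼u′ , inj₂ (refl , lt))
  ... | inj₂ gt = inj₂ (∼-sym u∼u′ , inj₂ (refl , gt))
  orient′ (p≢q , u∼u′ , inj₂ a) with orient a
  ... | inj₁ v⟶v′ = inj₁ (u∼u′ , inj₁ v⟶v′)
  ... | inj₂ v′⟶v = inj₂ (∼-sym u∼u′ , inj₁ v′⟶v)

  asym′ : ∀ {p q} → p ⟶′ q → ¬ q ⟶′ p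
  asym′ (_ , inj₁ a)           (_ , inj₁ b)           = asym a b
  asym′ (_ , inj₁ a)           (_ , inj₂ (refl , _))  = asym a a
  asym′ (_ , inj₂ (refl , _))  (_ , inj₁ b)           = asym b b
  asym′ (_ , inj₂ (_ , lt))    (_ , inj₂ (_ , gt))    = <ᶠ-asym lt gt

  perfect′ : ∀ {p q r} → p ⟶′ q → p ⟶′ r → q ≢ r → P.Adj q r
  perfect′ {p} {q} {r} (u∼ , a) (u∼′ , b) q≢r = q≢r , ∼-trans (∼-sym u∼) u∼′ , out a b
    where
    out : ∀ {v v′ v″} {A B : Set} → v ⟶ v′ ⊎ v ≡ v′ × A → v ⟶ v″ ⊎ v ≡ v″ × B → v″ H.∈N[ v′ ]
    out {v′ = v′} {v″} (inj₁ a) (inj₁ b) with v″ H.≟ⱽ v′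
    ... | yes eq  = inj₁ eq
    ... | no  neq = inj₂ (perfect a b (neq ∘ sym))
    out (inj₁ a)          (inj₂ (refl , _)) = inj₂ (H.adj-sym (⟶⇒adj a))
    out (inj₂ (refl , _)) (inj₁ b)          = inj₂ (⟶⇒adj b)
    out (inj₂ (refl , _)) (inj₂ (refl , _)) = inj₁ refl

-- Gluing componentwise structures into global labellings.

record GluedTwoComplete (G : Graph) : Set where
  open Graph G
  open ClosedAdjacency G
  field
    inA inB : V → Bool

  Common : Rel V 0ℓ
  Common u v = (inA u ≡ true × inA v ≡ true) ⊎ (inB u ≡ true × inB v ≡ true)

  field
    ∼⇒common : ∀ {u v} → u ∼ v → Common u v
    common⇒∼ : ∀ {u v} → u ⋆ v → Common u v → u ∼ v

-- Labels in different components come from unrelated certificates, whence the connectedness premise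
-- of `common⇒∼`.
glue-two-complete : ∀ G → EveryComponent TwoComplete G → GluedTwoComplete G
glue-two-complete G comps = record
  { inA      = glue A
  ; inB      = glue B
  ; ∼⇒common = λ {u} {v} u∼v → glued (∼⇒⋆ u∼v) (common-in u∼v)
  ; common⇒∼ = ∼-in
  }
  where
  open Graph G
  open ClosedAdjacency G
  open Reachability G
  open Equivalence using (to; from)
  module K r = TwoComplete (comps (component r) (component-isComponent r))

  A B : ∀ r → Σ V (_∈ component r) → Bool
  A = K.A
  B = K.B

  CommonIn : ∀ r (u v : Σ V (_∈ component r)) → Set
  CommonIn r u v = (T (A r u) × T (A r v)) ⊎ (T (B r u) × T (B r v))

  module _ {u v} (u⋆v : u ⋆ v) where
    private
      r = representative u
      u′ v′ : Σ V (_∈ component r)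
      u′ = u , ∈-representative u
      v′ = v , ⋆⇒∈-representative u⋆v

    glued : CommonIn r u′ v′ →
            (glue A u ≡ true × glue A v ≡ true) ⊎ (glue B u ≡ true × glue B v ≡ true)
    glued (inj₁ (a , a′)) = inj₁ (to T-≡ a , trans (glue-⋆ A u⋆v) (to T-≡ a′))
    glued (inj₂ (b , b′)) = inj₂ (to T-≡ b , trans (glue-⋆ B u⋆v) (to T-≡ b′))

    unglued : (glue A u ≡ true × glue A v ≡ true) ⊎ (glue B u ≡ true × glue B v ≡ true) →
              CommonIn r u′ v′
    unglued (inj₁ (a , a′)) = inj₁ (from T-≡ a , from T-≡ (trans (sym (glue-⋆ A u⋆v)) a′))
    unglued (inj₂ (b , b′)) = inj₂ (from T-≡ b , from T-≡ (trans (sym (glue-⋆ B u⋆v)) b′))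

    ∼-in : (glue A u ≡ true × glue A v ≡ true) ⊎ (glue B u ≡ true × glue B v ≡ true) → u ∼ v
    ∼-in common with v ≟ⱽ u
    ... | yes v≡u = inj₁ v≡u
    ... | no  v≢u = inj₂ (from (K.edges r u′ v′) ((λ eq → v≢u (sym (cong proj₁ eq))) , unglued common))

  common-in : ∀ {u v} (u∼v : u ∼ v) →
              CommonIn (representative u) (u , ∈-representative u) (v , ⋆⇒∈-representative (∼⇒⋆ u∼v))
  common-in {u} (inj₁ refl) with K.cover (representative u) (u , ∈-representative u)
  ... | inj₁ a = inj₁ (a , subst (T ∘ A _) (Σ-T-≡ refl) a)
  ... | inj₂ b = inj₂ (b , subst (T ∘ B _) (Σ-T-≡ refl) b)
  common-in {u} (inj₂ a) = proj₂ (to (K.edges (representative u) _ _) a)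

-- An order-free form of the co-chain structure: nestedness becomes comparability under `⊑`,
-- demanded on both sides.
record GluedCoChain (G : Graph) : Set where
  open Graph G
  open ClosedAdjacency G
  field
    side       : V → Bool
    side-∼     : ∀ {u v} → u ⋆ v → side u ≡ side v → u ∼ v
    side-total : ∀ {u v} → u ⋆ v → side u ≡ side v → u ⊑ v ⊎ v ⊑ u

module CoChainComponent (G : Graph) {C} (isC : IsComponent G C) (K : CoChain (induced G C)) where
  open Graph G
  open ClosedAdjacency G
  open CoChain K
  open Equivalence using (to; from)

  X-∼ : ∀ {u v : Σ V (_∈ C)} → X u ≡ X v → proj₁ u ∼ proj₁ v
  X-∼ {u} {v} eq with proj₁ v ≟ⱽ proj₁ u
  ... | yes v≡u = inj₁ v≡u
  ... | no  v≢u = inj₂ (by-side (cover u) (cover v))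
    where
    u≢v : u ≢ v
    u≢v u≡v = v≢u (sym (cong proj₁ u≡v))
    by-side : T (X u) ⊎ T (Y u) → T (X v) ⊎ T (Y v) → Adj (proj₁ u) (proj₁ v)
    by-side (inj₁ xu) _         = X-clique xu (subst T eq xu) u≢v
    by-side (inj₂ _)  (inj₁ xv) = X-clique (subst T (sym eq) xv) xv u≢v
    by-side (inj₂ yu) (inj₂ yv) = Y-clique yu yv u≢v

  ∼⇒∈C : ∀ {u v} → u ∈ C → u ∼ v → v ∈ C
  ∼⇒∈C {u} {v} u∈ u∼v = from (proj₂ isC v) (to (proj₂ isC u) u∈ ◅◅ ∼⇒⋆ u∼v)

  -- A component contains all neighbours of its vertices, so inclusion of neighbourhoods inside it
  -- is inclusion in `G`.
  nested⇒⊑ : ∀ {u v : Σ V (_∈ C)} →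
             (∀ {w} → Graph._∈N[_] (induced G C) w u → Graph._∈N[_] (induced G C) w v) →
             proj₁ u ⊑ proj₁ v
  nested⇒⊑ {u} u⊆v {w} u∼w
    with u⊆v {w , ∼⇒∈C (proj₂ u) u∼w} ([ inj₁ ∘ Σ-T-≡ , inj₂ ]′ u∼w)
  ... | inj₁ eq = inj₁ (cong proj₁ eq)
  ... | inj₂ a  = inj₂ a

  x-total : ∀ i j → proj₁ (x i) ⊑ proj₁ (x j) ⊎ proj₁ (x j) ⊑ proj₁ (x i)
  x-total i j with <ᶠ-cmp i j
  ... | tri< lt _ _   = inj₁ (nested⇒⊑ {x i} {x j} (nested lt))
  ... | tri≈ _ refl _ = inj₁ id
  ... | tri> _ _ gt   = inj₂ (nested⇒⊑ {x j} {x i} (nested gt))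

  X-total : ∀ {u v : Σ V (_∈ C)} → T (X u) → T (X v) → proj₁ u ⊑ proj₁ v ⊎ proj₁ v ⊑ proj₁ u
  X-total {u} {v} xu xv =
    subst₂ (λ a b → proj₁ a ⊑ proj₁ b ⊎ proj₁ b ⊑ proj₁ a) (x-position u xu) (x-position v xv) (x-total _ _)
    where
    x-position : ∀ w (xw : T (X w)) → x (Inverse.from ordering (w , xw)) ≡ w
    x-position w xw = cong proj₁ (Inverse.strictlyInverseˡ ordering (w , xw))

  -- Incomparable vertices of Y would have private neighbours in X, which are comparable.
  side-total : ∀ {u v : Σ V (_∈ C)} → X u ≡ X v → proj₁ u ⊑ proj₁ v ⊎ proj₁ v ⊑ proj₁ u
  side-total {u} {v} eq with ⊑-or-witness (proj₁ u) (proj₁ v) | ⊑-or-witness (proj₁ v) (proj₁ u)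
  ... | inj₁ u⊑v | _        = inj₁ u⊑v
  ... | inj₂ _   | inj₁ v⊑u = inj₂ v⊑u
  ... | inj₂ (s , u∼s , v≁s) | inj₂ (t , v∼t , u≁t) = ⊥-elim (absurd (X u ≟ᵇ true))
    where
    s′ t′ : Σ V (_∈ C)
    s′ = s , ∼⇒∈C (proj₂ u) u∼s
    t′ = t , ∼⇒∈C (proj₂ v) v∼t

    absurd : Dec (X u ≡ true) → ⊥
    absurd (yes xu) with X-total {u} {v} (from T-≡ xu) (from T-≡ (trans (sym eq) xu))
    ... | inj₁ u⊑v = v≁s (u⊑v u∼s)
    ... | inj₂ v⊑u = u≁t (v⊑u v∼t)
    absurd (no ¬xu) with X-total {s′} {t′} xs xt
      where
      xs = from T-≡ (trans (¬-not λ x≡ → v≁s (X-∼ {v} {s′} (trans (sym eq) (sym x≡)))) (cong not (¬-not ¬xu)))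
      xt = from T-≡ (trans (¬-not λ x≡ → u≁t (X-∼ {u} {t′} (sym x≡))) (cong not (¬-not ¬xu)))
    ... | inj₁ s⊑t = u≁t (∼-sym (s⊑t (∼-sym u∼s)))
    ... | inj₂ t⊑s = v≁s (∼-sym (t⊑s (∼-sym v∼t)))

glue-cochain : ∀ G → EveryComponent CoChain G → GluedCoChain G
glue-cochain G comps = record
  { side       = glue X
  ; side-∼     = λ u⋆v eq → Component.X-∼ _ (same-side u⋆v eq)
  ; side-total = λ u⋆v eq → Component.side-total _ (same-side u⋆v eq)
  }
  where
  open Graph G
  open ClosedAdjacency G
  open Reachability G
  module Component r =
    CoChainComponent G (component-isComponent r) (comps (component r) (component-isComponent r))

  X : ∀ r → Σ V (_∈ component r) → Bool
  X r = CoChain.X (comps (component r) (component-isComponent r))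

  same-side : ∀ {u v} (u⋆v : u ⋆ v) → glue X u ≡ glue X v →
              X _ (u , ∈-representative u) ≡ X _ (v , ⋆⇒∈-representative u⋆v)
  same-side u⋆v eq = trans eq (glue-⋆ X u⋆v)

-- Orienting a 2-complete factor against a co-chain factor.

Cmp : Bool → Bool → Set → Set
Cmp true  true  P = P
-- Between unequal labels the arc always enters `true`; equal labels leave the decision to `P`.
Cmp true  false P = ⊥
Cmp false true  P = ⊤
Cmp false false P = P

cmp-total : ∀ a b {P Q : Set} → P ⊎ Q → Cmp a b P ⊎ Cmp b a Q
cmp-total true  true  p⊎q = p⊎q
cmp-total true  false _   = inj₂ tt
cmp-total false true  _   = inj₁ tt
cmp-total false false p⊎q = p⊎q

cmp-asym : ∀ a b {P Q : Set} → (P → ¬ Q) → Cmp a b P → ¬ Cmp b a Q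
cmp-asym true  true  asym p q = asym p q
cmp-asym false false asym p q = asym p q

cmp-true : ∀ {a} b {P : Set} → a ≡ true → Cmp a b P → b ≡ true
cmp-true true refl _ = refl

cmp-tie : ∀ a b {P : Set} → Cmp a b P → P ⊎ a ≡ false
cmp-tie true  true  p = inj₁ p
cmp-tie false _     _ = inj₂ refl

false⇒≢true : ∀ {b} → b ≡ false → b ≢ true
false⇒≢true refl ()

module TwoComplete⊠CoChain (G H : Graph) (𝒢 : GluedTwoComplete G) (ℋ : GluedCoChain H) where
  open GluedTwoComplete 𝒢
  open GluedCoChain ℋ
  open ClosedAdjacency H
  open Graph (G ⊠ H)
  open Inverse enum using () renaming (to to index)
  private
    module GC = ClosedAdjacency G

  -- Lexicographic: the index matters only when the closed neighbourhoods in `H` coincide.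
  _≺_ : Rel V 0ℓ
  p ≺ q = proj₂ p ⊑ proj₂ q × (proj₂ q ⊑ proj₂ p → index p <ᶠ index q)

  ≺-asym : ∀ {p q} → p ≺ q → ¬ q ≺ p
  ≺-asym (p⊑q , p<q) (q⊑p , q<p) = <ᶠ-asym (p<q q⊑p) (q<p p⊑q)

  -- The inclusion that agrees with the index is tried first; a witness against it makes the
  -- opposite inclusion strict, so the index condition there is vacuous.
  ≺-total : ∀ {p q} → p ≢ q → proj₂ p ∼ proj₂ q → side (proj₂ p) ≡ side (proj₂ q) → p ≺ q ⊎ q ≺ p
  ≺-total {p} {q} p≢q p∼q eq with index-total (G ⊠ H) p≢q
  ≺-total {p} {q} p≢q p∼q eq | inj₁ lt with side-total (∼⇒⋆ p∼q) eq | ⊑-or-witness (proj₂ p) (proj₂ q)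
  ... | _        | inj₁ p⊑q           = inj₁ (p⊑q , λ _ → lt)
  ... | inj₁ p⊑q | inj₂ _             = inj₁ (p⊑q , λ _ → lt)
  ... | inj₂ q⊑p | inj₂ (_ , p∼w , q≁w) = inj₂ (q⊑p , λ p⊑q → contradiction (p⊑q p∼w) q≁w)
  ≺-total {p} {q} p≢q p∼q eq | inj₂ gt with side-total (∼⇒⋆ p∼q) eq | ⊑-or-witness (proj₂ q) (proj₂ p)
  ... | _        | inj₁ q⊑p           = inj₂ (q⊑p , λ _ → gt)
  ... | inj₂ q⊑p | inj₂ _             = inj₂ (q⊑p , λ _ → gt)
  ... | inj₁ p⊑q | inj₂ (_ , q∼w , p≁w) = inj₁ (p⊑q , λ q⊑p → contradiction (q⊑p q∼w) p≁w)

  BothInB : Rel V 0ℓ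
  BothInB p q = inB (proj₁ p) ≡ true × inB (proj₁ q) ≡ true

  bothInB? : Decidable BothInB
  bothInB? p q = (inB (proj₁ p) ≟ᵇ true) ×-dec (inB (proj₁ q) ≟ᵇ true)

  -- The first two arguments are the sides of p and q, with true standing for X.
  Arc : Bool → Bool → Rel V 0ℓ
  Arc true  true  p q = Cmp (inB (proj₁ p)) (inB (proj₁ q)) (p ≺ q)
  Arc false false p q = Cmp (inA (proj₁ p)) (inA (proj₁ q)) (p ≺ q)
  Arc true  false p q = BothInB p q
  Arc false true  p q = ¬ BothInB p q

  arc-total : ∀ s t {p q} → (s ≡ t → p ≺ q ⊎ q ≺ p) → Arc s t p q ⊎ Arc t s q p
  arc-total true  true  total = cmp-total _ _ (total refl)
  arc-total false false total = cmp-total _ _ (total refl)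
  arc-total true  false {p} {q} _ with bothInB? p q
  ... | yes b = inj₁ b
  ... | no ¬b = inj₂ (¬b ∘ swap)
  arc-total false true  {p} {q} _ with bothInB? p q
  ... | yes b = inj₂ (swap b)
  ... | no ¬b = inj₁ ¬b

  arc-asym : ∀ s t {p q} → Arc s t p q → ¬ Arc t s q p
  arc-asym true  true  {p} {q} = cmp-asym (inB (proj₁ p)) (inB (proj₁ q)) ≺-asym
  arc-asym false false {p} {q} = cmp-asym (inA (proj₁ p)) (inA (proj₁ q)) ≺-asym
  arc-asym true  false b ¬b    = ¬b (swap b)
  arc-asym false true  ¬b b    = ¬b (swap b)

  arc-B : ∀ t {p q} → Arc true t p q → inB (proj₁ p) ≡ true → inB (proj₁ q) ≡ true
  arc-B true  arc b = cmp-true _ b arc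
  arc-B false arc _ = proj₂ arc

  -- An arc from Y to X says that the `G`-coordinates are not both in B; being closed-adjacent, they
  -- share A.
  arc-A : ∀ t {p q} → Arc false t p q → proj₁ p GC.∼ proj₁ q → inA (proj₁ p) ≡ true → inA (proj₁ q) ≡ true
  arc-A false arc _   a = cmp-true _ a arc
  arc-A true  arc p∼q _ = [ proj₂ , (λ b → contradiction b arc) ]′ (∼⇒common p∼q)

  -- If `p` carries the label its side preserves (`inB` on X, `inA` on Y), both out-neighbours
  -- inherit it. Otherwise every neighbour over `G` shares the other label with `p`.
  out-common : ∀ s t t′ {p q r} → Arc s t p q → Arc s t′ p r →
               proj₁ p GC.∼ proj₁ q → proj₁ p GC.∼ proj₁ r → Common (proj₁ q) (proj₁ r)
  out-common true t t′ {p} arc arc′ p∼q p∼r with inB (proj₁ p) in eq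
  ... | true  = inj₂ (arc-B t arc eq , arc-B t′ arc′ eq)
  ... | false = inj₁ (only-A p∼q , only-A p∼r)
    where
    only-A : ∀ {g} → proj₁ p GC.∼ g → inA g ≡ true
    only-A p∼g = [ proj₂ , (λ b → contradiction (proj₁ b) (false⇒≢true eq)) ]′ (∼⇒common p∼g)
  out-common false t t′ {p} arc arc′ p∼q p∼r with inA (proj₁ p) in eq
  ... | true  = inj₁ (arc-A t arc p∼q eq , arc-A t′ arc′ p∼r eq)
  ... | false = inj₂ (only-B p∼q , only-B p∼r)
    where
    only-B : ∀ {g} → proj₁ p GC.∼ g → inB g ≡ true
    only-B p∼g = [ (λ a → contradiction (proj₁ a) (false⇒≢true eq)) , proj₂ ]′ (∼⇒common p∼g)

  -- The arc to the opposite side forces `p` to carry the label its own side preserves, so the arc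
  -- to `q` was a tie settled by `≺`.
  out-⊑ : ∀ s {p q r} → Arc s s p q → Arc s (not s) p r → proj₁ p GC.∼ proj₁ r → proj₂ p ⊑ proj₂ q
  out-⊑ true {p} {q} arc b _ with cmp-tie (inB (proj₁ p)) (inB (proj₁ q)) arc
  ... | inj₁ p≺q = proj₁ p≺q
  ... | inj₂ eq  = contradiction (proj₁ b) (false⇒≢true eq)
  out-⊑ false {p} {q} arc ¬b p∼r with cmp-tie (inA (proj₁ p)) (inA (proj₁ q)) arc | ∼⇒common p∼r
  ... | inj₁ p≺q | _      = proj₁ p≺q
  ... | inj₂ eq  | inj₁ a = contradiction (proj₁ a) (false⇒≢true eq)
  ... | inj₂ _   | inj₂ b = contradiction b ¬b

  -- For targets on different sides, one shares the side of `p`; its closed neighbourhood contains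
  -- that of `p`, hence the other target.
  out-∼ᴴ : ∀ s t t′ {p q r} → Arc s t p q → Arc s t′ p r → proj₁ p GC.∼ proj₁ q → proj₁ p GC.∼ proj₁ r →
           proj₂ p ∼ proj₂ q → proj₂ p ∼ proj₂ r → (t ≡ t′ → proj₂ q ∼ proj₂ r) → proj₂ q ∼ proj₂ r
  out-∼ᴴ _     true  true  _ _ _ _ _ _ same = same refl
  out-∼ᴴ _     false false _ _ _ _ _ _ same = same refl
  out-∼ᴴ true  true  false {p} {q} {r} arc arc′ _ p∼r _ p∼ᴴr _ = out-⊑ true {p} {q} {r} arc arc′ p∼r p∼ᴴr
  out-∼ᴴ true  false true  {p} {q} {r} arc arc′ p∼q _ p∼ᴴq _ _ = ∼-sym (out-⊑ true {p} {r} {q} arc′ arc p∼q p∼ᴴq)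
  out-∼ᴴ false false true  {p} {q} {r} arc arc′ _ p∼r _ p∼ᴴr _ = out-⊑ false {p} {q} {r} arc arc′ p∼r p∼ᴴr
  out-∼ᴴ false true  false {p} {q} {r} arc arc′ p∼q _ p∼ᴴq _ _ = ∼-sym (out-⊑ false {p} {r} {q} arc′ arc p∼q p∼ᴴq)

  sideOf : V → Bool
  sideOf p = side (proj₂ p)

  orientable : OnePerfectlyOrientable (G ⊠ H)
  orientable = record
    { _⟶_    = λ p q → Adj p q × Arc (sideOf p) (sideOf q) p q
    ; ⟶⇒adj  = proj₁
    ; orient = orient
    ; asym   = λ {p} {q} (_ , arc) (_ , arc′) → arc-asym (sideOf p) (sideOf q) arc arc′
    } , perfect
    where
    orient : ∀ {p q} → Adj p q →
             Adj p q × Arc (sideOf p) (sideOf q) p q ⊎ Adj q p × Arc (sideOf q) (sideOf p) q p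
    orient {p} {q} a@(p≢q , _ , p∼q) =
      [ (λ arc → inj₁ (a , arc)) , (λ arc → inj₂ (adj-sym {p} {q} a , arc)) ]′
        (arc-total (sideOf p) (sideOf q) (≺-total p≢q p∼q))

    perfect : ∀ {p q r} → Adj p q × Arc (sideOf p) (sideOf q) p q → Adj p r × Arc (sideOf p) (sideOf r) p r →
              q ≢ r → Adj q r
    perfect {p} {q} {r} ((_ , p∼q , p∼ᴴq) , arc) ((_ , p∼r , p∼ᴴr) , arc′) q≢r =
      q≢r ,
      common⇒∼ (GC.∼⇒⋆ (GC.∼-sym p∼q) ◅◅ GC.∼⇒⋆ p∼r)
        (out-common (sideOf p) (sideOf q) (sideOf r) arc arc′ p∼q p∼r) ,
      out-∼ᴴ (sideOf p) (sideOf q) (sideOf r) arc arc′ p∼q p∼r p∼ᴴq p∼ᴴr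
        (side-∼ (∼⇒⋆ (∼-sym p∼ᴴq) ◅◅ ∼⇒⋆ p∼ᴴr))

two-complete⊠cochain : ∀ G H → EveryComponent TwoComplete G → EveryComponent CoChain H →
                       OnePerfectlyOrientable (G ⊠ H)
two-complete⊠cochain G H compsG compsH =
  TwoComplete⊠CoChain.orientable G H (glue-two-complete G compsG) (glue-cochain H compsH)

theorem22 : (G H : Graph) → 2 ≤ Graph.order G → 2 ≤ Graph.order H →
    OnePerfectlyOrientable (G ⊠ H) ⇔
    (((EveryComponent Complete G × OnePerfectlyOrientable H) ⊎
    (EveryComponent Complete H × OnePerfectlyOrientable G)) ⊎
    ((EveryComponent TwoComplete G × EveryComponent CoChain H) ⊎
    (EveryComponent TwoComplete H × EveryComponent CoChain G)))
theorem22 G H 2≤G 2≤H = mk⇔ (orientable⇒characterisation G H 2≤G 2≤H) λ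
  { (inj₁ (inj₁ (complete , po)))         → complete⊠orientable G H complete po
  ; (inj₁ (inj₂ (complete , po)))         → ⊠-comm H G (complete⊠orientable H G complete po)
  ; (inj₂ (inj₁ (twoComplete , cochain))) → two-complete⊠cochain G H twoComplete cochain
  ; (inj₂ (inj₂ (twoComplete , cochain))) → ⊠-comm H G (two-complete⊠cochain H G twoComplete cochain)
  }
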